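{- Any scheduling scheme with $b_0=b_1=\dots=b_{\log(n/D)}=D$ (so the last level is $L=\log(n/D)$), where $D\ge 6$, approximates the longest palindrome with multiplicative error $1+\mathcal{O}(1/D)$.
   Context: Streaming setting: the characters of a text $T[1..n]$ arrive one by one; time $h$ means just after reading $T[h]$. Only even-length palindromes are considered: the palindromic radius at $c$ is the largest $R(c)$ such that $T[c..(c+R(c)-1)]$ equals the reversal of $T[(c-R(c))..(c-1)]$, and palindromes are measured by radius. Landmarks: there are levels $0,1,\dots,L$ with $L\le\log n$ (logarithm base 2), with sizes $b_0,\dots,b_L$. At time $h$, level $\lambda$ consists of the $b_\lambda$ most recently seen positions divisible by $2^\lambda$, i.e. the positions $2^\lambda(\lfloor h/2^\lambda\rfloor-i)\ge 0$ for $i=0,1,\dots,b_\lambda-1$. A landmark at $h$ is a position belonging to some level; for each landmark $t$ the Karp-Rabin fingerprint of $T[1..t]$ is stored, and the fingerprint of $T[1..h]$ is always available. Processes: for every center $c$ there is a process $P(c)$. At time $h$, $P(c)$ is alive if there is no $\Delta\ge 0$ with $c+\Delta\le h$ and $T[c-1-\Delta]\ne T[c+\Delta]$, and dead otherwise. $P(c)$ can be run at time $h$ when $2c-h-2$ is a landmark at $h$: it checks by comparing fingerprints whether $T[(2c-h-1)..h]$ is a palindrome (equivalently $R(c)\ge h-c+1$). If so it succeeds and the reported answer becomes the maximum of its previous value (initially $0$) and $h-c+1$; otherwise it fails. False positives of fingerprint comparisons are assumed not to occur (this holds with high probability). Scheduling scheme: an algorithm which after reading each $T[h]$ runs some of the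 processes, guaranteeing that any alive $P(c)$ such that $2c-h-2$ is a landmark at $h$ is run, unless it can be sure that $P(c)$ would fail anyway, or there is another $P(c')$ with $c'<c$ such that $2c'-h-2$ is also a landmark at $h$ and it can be sure that $P(c')$ succeeds. Multiplicative error $1+\varepsilon$: after reading each $T[h]$ the reported answer $\ell$ satisfies $\ell\le R\le(1+\varepsilon)\ell$, where $R$ is the largest palindromic radius in $T[1..h]$. The constant in $\mathcal{O}(1/D)$ is absolute. The quantity $n/D$ is understood to be a power of two (rounding is ignored). -}

module Defs where

open import Data.Fin.Base using (Fin; toℕ)
open import Data.Integer.Base using (+_)
open import Data.List.Base
  using (List; length; map; filter; take; drop; head; reverse; upTo; applyUpTo)
open import Data.List.Extrema.Nat using (max)
open import Data.List.Membership.Propositional using (_∈_)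
open import Data.List.Properties using (≡-dec)
open import Data.Maybe.Base using (Maybe; nothing)
open import Data.Nat.Base
  using (ℕ; zero; suc; _+_; _*_; _∸_; _^_; _/_; _≤_; _<_)
open import Data.Nat.Properties using (m^n≢0; _≤?_; _<?_)
open import Data.Product.Base using (∃-syntax; _×_)
open import Data.Rational.Base as ℚ using (ℚ; 1ℚ)
open import Data.Sum.Base using (_⊎_)
open import Relation.Binary.Definitions using (DecidableEquality)
open import Relation.Binary.PropositionalEquality using (_≡_; _≢_)
open import Relation.Nullary.Decidable using (Dec; _×-dec_)
open import Relation.Nullary.Negation using (¬_)

-- Throughout, w is the list of characters read so far, so the current time
-- is h = length w.  Positions in texts are 1-based.

module _ {A : Set} where

  -- Position 0 holds no character, so it differs from every position of the
  -- text.  Positions left of the text are truncated to 0.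
  infix 8 _[_] _[_⋯_]

  _[_] : List A → ℕ → Maybe A
  w [ zero  ] = nothing
  w [ suc i ] = head (drop i w)

  _[_⋯_] : List A → ℕ → ℕ → List A
  w [ i ⋯ j ] = drop (i ∸ 1) (take j w)

  Palindrome : List A → Set
  Palindrome s = s ≡ reverse s

  -- The two inequalities say that both factors lie inside the text.
  Mirror : List A → ℕ → ℕ → Set
  Mirror w c r =
    r < c × c + r ≤ suc (length w) ×
    w [ c ⋯ c + r ∸ 1 ] ≡ reverse (w [ c ∸ r ⋯ c ∸ 1 ])

  Alive : List A → ℕ → Set
  Alive w c = ¬ (∃[ Δ ] (c + Δ ≤ length w × w [ c ∸ 1 ∸ Δ ] ≢ w [ c + Δ ]))

  -- The outcome of P(c).  As false positives of fingerprint comparisons are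
  -- excluded, comparing fingerprints is the same as comparing the factors.
  Succeeds : List A → ℕ → Set
  Succeeds w c = Palindrome (w [ 2 * c ∸ length w ∸ 1 ⋯ length w ])

module _ {A : Set} (_≟_ : DecidableEquality A) where

  mirror? : ∀ w c r → Dec (Mirror {A} w c r)
  mirror? w c r = (r <? c) ×-dec (c + r ≤? suc (length w)) ×-dec ≡-dec _≟_ _ _

  succeeds? : ∀ w c → Dec (Succeeds {A} w c)
  succeeds? w c = ≡-dec _≟_ _ _

  palindromicRadius : List A → ℕ → ℕ
  palindromicRadius w c = max 0 (filter (mirror? w c) (upTo c))

  largestRadius : List A → ℕ
  largestRadius w = max 0 (map (palindromicRadius w) (applyUpTo suc (length w)))

record Levels : Set where
  field
    L : ℕ
    b : Fin (suc L) → ℕ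

Landmark : Levels → ℕ → ℕ → Set
Landmark lv h t =
  ∃[ k ] ∃[ i ] (i < b k × i ≤ quot k × t ≡ 2 ^ toℕ k * (quot k ∸ i))
  where
  open Levels lv
  quot : Fin (suc L) → ℕ
  quot k = _/_ h (2 ^ toℕ k) {{m^n≢0 2 (toℕ k)}}

-- The equation says that 2c − h − 2 is the landmark t.
CanRun : {A : Set} → Levels → List A → ℕ → Set
CanRun lv w c = ∃[ t ] (Landmark lv (length w) t × 2 * c ≡ t + length w + 2)

-- A scheme for texts of length n.  Its decisions depend only on the part of
-- the text read so far.  The predicates SureFails and SureSucceeds stand for
-- whatever the algorithm is able to infer; they are only required to be sound.
record Scheme (A : Set) (n : ℕ) (lv : Levels) : Set₁ where
  field
    runs         : List A → List ℕ
    SureFails    : List A → ℕ → Set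
    SureSucceeds : List A → ℕ → Set

    runs-canRun : ∀ w → 1 ≤ length w → length w ≤ n →
      ∀ c → c ∈ runs w → CanRun lv w c

    sureFails-sound : ∀ w → 1 ≤ length w → length w ≤ n →
      ∀ c → CanRun lv w c → SureFails w c → ¬ Succeeds w c

    sureSucceeds-sound : ∀ w → 1 ≤ length w → length w ≤ n →
      ∀ c → CanRun lv w c → SureSucceeds w c → Succeeds w c

    guarantee : ∀ w → 1 ≤ length w → length w ≤ n →
      ∀ c → Alive w c → CanRun lv w c →
        c ∈ runs w
      ⊎ SureFails w c
      ⊎ ∃[ c′ ] (c′ < c × CanRun lv w c′ × SureSucceeds w c′)

module _ {A : Set} (_≟_ : DecidableEquality A) {n : ℕ} {lv : Levels} where

  -- The answer reported after reading the first h characters of T; a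
  -- successful run of P(c) at time h contributes the radius h − c + 1.
  answer : Scheme A n lv → List A → ℕ → ℕ
  answer S T zero = 0
  answer S T h@(suc h-1) =
    max (answer S T h-1)
        (map (λ c → suc h ∸ c) (filter (succeeds? _≟_ w) (Scheme.runs S w)))
    where
    w : List A
    w = take h T

  -- Multiplicative error 1 + ε.
  Approximates : Scheme A n lv → ℚ → Set
  Approximates S ε =
    ∀ (T : List A) → length T ≡ n → ∀ h → 1 ≤ h → h ≤ n →
    let ℓ = answer S T h
        R = largestRadius _≟_ (take h T)
    in ℓ ≤ R × (+ R ℚ./ 1) ℚ.≤ (1ℚ ℚ.+ ε) ℚ.* (+ ℓ ℚ./ 1)

{-# OPTIONS --safe #-}

-- If R is the largest radius and 2R < D, the position before the palindrome is a
-- landmark of level 0.  Otherwise choose the least k with 2R ≤ D·2^k.  Shrinking the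
-- palindrome by at most 2^k ≤ 4R/D moves that position to a multiple of 2^k, which
-- is a landmark at the time when the shrunken palindrome has just been read.  Its
-- process is alive and would succeed, so it is run, or else another process with
-- a smaller center, hence a larger radius, is run and succeeds.  Since D ≥ 6, a
-- loss of 4R/D is at most 12/D times the shrunken radius.

module Submission where

open import Data.Fin.Base using (Fin; toℕ; fromℕ<; zero)
open import Data.Fin.Properties using (toℕ-fromℕ<)
open import Data.Integer.Base using (+_)
import Data.Integer.Base as ℤ
import Data.Integer.Properties as ℤₚ
open import Data.List.Base
  using (List; []; _∷_; _++_; length; map; filter; take; drop; reverse; upTo; applyUpTo)
open import Data.List.Extrema.Nat using (⊥≤max; xs≤max; max≤v⁺; argmax-sel)
open import Data.List.Membership.Propositional using (_∈_)
open import Data.List.Membership.Propositional.Properties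
  using (∈-map⁺; ∈-map⁻; ∈-filter⁺; ∈-filter⁻; ∈-applyUpTo⁺; ∈-upTo⁺)
open import Data.List.Properties
  using (++-assoc; ++-identityʳ; length-++; length-reverse; length-take; reverse-++; reverse-involutive;
         unfold-reverse; take-all; take++drop≡id)
import Data.List.Relation.Unary.All as All
open import Data.Maybe.Base using (just)
open import Data.Nat.Base
  using (ℕ; zero; suc; NonZero; _+_; _*_; _∸_; _^_; _%_; _≤_; _<_; _≤′_; ≤′-refl; ≤′-step; z≤n; s≤s; s≤s⁻¹)
import Data.Nat.Base as ℕ
import Data.Nat.DivMod as DivMod
open import Data.Nat.Divisibility using (_∣_; divides; 1∣_)
open import Data.Nat.Induction using (<-rec)
open import Data.Nat.Properties hiding (_≟_)
open import Data.Nat.Tactic.RingSolver using (solve-∀)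
open import Data.Product.Base using (∃-syntax; _×_; _,_; proj₁; proj₂)
open import Data.Rational.Base using (_/_; 1ℚ)
import Data.Rational.Base as ℚ
import Data.Rational.Properties as ℚₚ
import Data.Rational.Unnormalised.Base as ℚᵘ
import Data.Rational.Unnormalised.Properties as ℚᵘₚ
open import Data.Sum.Base using (_⊎_; inj₁; inj₂)
open import Function.Base using (id)
open import Relation.Binary.Definitions using (DecidableEquality)
open import Relation.Binary.PropositionalEquality
  using (_≡_; refl; sym; trans; cong; cong₂; subst; subst₂; module ≡-Reasoning)
open import Relation.Nullary.Decidable using (yes; no)
open import Relation.Nullary.Negation using (contradiction)
open import Defs

open Levels using (L; b)

-- Factors of concatenated texts and block decompositions

module _ {A : Set} where

  take-length-++ : ∀ (xs ys : List A) → take (length xs) (xs ++ ys) ≡ xs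
  take-length-++ []       ys = refl
  take-length-++ (x ∷ xs) ys = cong (x ∷_) (take-length-++ xs ys)

  take-length+-++ : ∀ (xs ys : List A) k → take (length xs + k) (xs ++ ys) ≡ xs ++ take k ys
  take-length+-++ []       ys k = refl
  take-length+-++ (x ∷ xs) ys k = cong (x ∷_) (take-length+-++ xs ys k)

  drop-length-++ : ∀ (xs ys : List A) → drop (length xs) (xs ++ ys) ≡ ys
  drop-length-++ []       ys = refl
  drop-length-++ (x ∷ xs) ys = drop-length-++ xs ys

  factor-++ : ∀ (p s q : List A) →
    (p ++ s ++ q) [ suc (length p) ⋯ length p + length s ] ≡ s
  factor-++ []      s q = take-length-++ s q
  factor-++ (x ∷ p) s q = factor-++ p s q

  []-length-++ : ∀ (p : List A) x q → (p ++ x ∷ q) [ suc (length p) ] ≡ just x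
  []-length-++ []      x q = refl
  []-length-++ (_ ∷ p) x q = []-length-++ p x q

  split-length : ∀ m (w : List A) → m ≤ length w →
    ∃[ p ] ∃[ q ] (w ≡ p ++ q × length p ≡ m)
  split-length m w m≤ =
    take m w , drop m w , sym (take++drop≡id m w) , trans (length-take m w) (m≤n⇒m⊓n≡m m≤)

  -- An even palindrome of radius r preceded by exactly t characters; its
  -- center is suc (t + r).
  PalindromeAt : List A → ℕ → ℕ → Set
  PalindromeAt w t r =
    ∃[ p ] ∃[ a ] ∃[ q ] (w ≡ p ++ a ++ reverse a ++ q × length p ≡ t × length a ≡ r)

  -- Both converses, from `Mirror` and from `Succeeds`, first cut the text into blocks of the right
  -- lengths with no symmetry assumed. Only `b ≡ reverse a` then remains to be shown.
  split-around : ∀ t r (w : List A) → t + r + r ≤ length w →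
    ∃[ p ] ∃[ a ] ∃[ b ] ∃[ q ]
      (w ≡ p ++ a ++ b ++ q × length p ≡ t × length a ≡ r × length b ≡ r)
  split-around t r w le
    with u , q , refl , |u| ← split-length (t + r + r) w le
    with v , b , refl , |v| ← split-length (t + r) u (≤-trans (m≤m+n (t + r) r) (≤-reflexive (sym |u|)))
    with p , a , refl , |p| ← split-length t v (≤-trans (m≤m+n t r) (≤-reflexive (sym |v|)))
    = p , a , b , q
    , trans (++-assoc (p ++ a) b q) (++-assoc p a (b ++ q))
    , |p|
    , +-cancelˡ-≡ t (length a) r (trans (cong (_+ length a) (sym |p|)) (trans (sym (length-++ p)) |v|))
    , +-cancelˡ-≡ (t + r) (length b) r
        (trans (cong (_+ length b) (sym |v|)) (trans (sym (length-++ (p ++ a))) |u|))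

  left-factor : ∀ (p a s : List A) →
    (p ++ a ++ s) [ suc (length p + length a) ∸ length a ⋯ length p + length a ] ≡ a
  left-factor p a s
    rewrite m+n∸n≡m (suc (length p)) (length a) = factor-++ p a s

  right-factor : ∀ (p a b q : List A) → length b ≡ length a →
    (p ++ a ++ b ++ q) [ suc (length p + length a) ⋯ length p + length a + length a ] ≡ b
  right-factor p a b q |b|≡|a| = begin
    (p ++ a ++ b ++ q) [ suc (length p + length a) ⋯ length p + length a + length a ]
      ≡⟨ cong₂ (λ w k → w [ suc k ⋯ k + length a ]) (++-assoc p a (b ++ q)) (length-++ p) ⟨
    ((p ++ a) ++ b ++ q) [ suc (length (p ++ a)) ⋯ length (p ++ a) + length a ]
      ≡⟨ cong (λ k → ((p ++ a) ++ b ++ q) [ suc (length (p ++ a)) ⋯ length (p ++ a) + k ]) |b|≡|a| ⟨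
    ((p ++ a) ++ b ++ q) [ suc (length (p ++ a)) ⋯ length (p ++ a) + length b ]
      ≡⟨ factor-++ (p ++ a) b q ⟩
    b ∎
    where open ≡-Reasoning

  length-around : ∀ (p a q : List A) →
    length (p ++ a ++ reverse a ++ q) ≡ length p + length a + length a + length q
  length-around p a q = begin
    length (p ++ a ++ reverse a ++ q)                      ≡⟨ length-++ p ⟩
    length p + length (a ++ reverse a ++ q)                ≡⟨ cong (λ x → length p + x) (length-++ a) ⟩
    length p + (length a + length (reverse a ++ q))        ≡⟨ +-assoc (length p) _ _ ⟨
    length p + length a + length (reverse a ++ q)
      ≡⟨ cong (λ x → length p + length a + x) (length-++ (reverse a)) ⟩
    length p + length a + (length (reverse a) + length q)  ≡⟨ +-assoc (length p + length a) _ _ ⟨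
    length p + length a + length (reverse a) + length q
      ≡⟨ cong (λ k → length p + length a + k + length q) (length-reverse a) ⟩
    length p + length a + length a + length q              ∎
    where open ≡-Reasoning

  -- Palindromes by start and radius: mirrored factors and success

  length-palindromeAt : ∀ {w t r} → PalindromeAt w t r → t + r + r ≤ length w
  length-palindromeAt (p , a , q , refl , refl , refl) =
    ≤-trans (m≤m+n _ (length q)) (≤-reflexive (sym (length-around p a q)))

  palindromeAt⇒mirror : ∀ {w t r} → PalindromeAt w t r → Mirror w (suc (t + r)) r
  palindromeAt⇒mirror pal@(p , a , q , refl , refl , refl) =
      s≤s (m≤n+m (length a) (length p))
    , s≤s (length-palindromeAt pal)
    , trans (right-factor p a (reverse a) q (length-reverse a))
            (cong reverse (sym (left-factor p a (reverse a ++ q))))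

  mirror⇒palindromeAt : ∀ {w} t r → Mirror w (suc (t + r)) r → PalindromeAt w t r
  mirror⇒palindromeAt {w} t r (_ , fits , eq)
    with p , a , b , q , refl , refl , refl , |b| ← split-around t r w (s≤s⁻¹ fits)
    = p , a , q , cong (λ s → p ++ a ++ s ++ q) b≡a⁻¹ , refl , refl
    where
    b≡a⁻¹ : b ≡ reverse a
    b≡a⁻¹ = trans (sym (right-factor p a b q |b|))
                  (trans eq (cong reverse (left-factor p a (b ++ q))))

  mirror⇒palindromeAt-center : ∀ {w c r} → Mirror w c r →
    ∃[ t ] (c ≡ suc (t + r) × PalindromeAt w t r)
  mirror⇒palindromeAt-center {w} {c} {r} m@(r<c , _) =
    c ∸ suc r , c≡ , mirror⇒palindromeAt (c ∸ suc r) r (subst (λ c → Mirror w c r) c≡ m)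
    where
    c≡ : c ≡ suc (c ∸ suc r + r)
    c≡ = trans (sym (m∸n+n≡m r<c)) (+-suc (c ∸ suc r) r)

  -- For c = t + r + 1 and h = t + 2r one has 2c - h - 1 = t + 1, so the factor tested by P(c) is
  -- the suffix left after the first t characters.
  whole-factor : ∀ t r {w : List A} → length w ≡ t + r + r →
    w [ 2 * suc (t + r) ∸ length w ∸ 1 ⋯ length w ] ≡ drop t w
  whole-factor t r {w} |w| = cong₂ drop start (take-all (length w) w ≤-refl)
    where
    double : ∀ t r → 2 * suc (t + r) ≡ suc (suc t) + (t + r + r)
    double = solve-∀
    start : 2 * suc (t + r) ∸ length w ∸ 1 ∸ 1 ≡ t
    start rewrite |w| | double t r = cong (λ k → k ∸ 1 ∸ 1) (m+n∸n≡m (suc (suc t)) (t + r + r))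

  palindromeAt⇒succeeds : ∀ {w t r} → PalindromeAt w t r → length w ≡ t + r + r →
    Succeeds w (suc (t + r))
  palindromeAt⇒succeeds {w} {t} {r} pal |w| =
    subst Palindrome (sym (whole-factor t r |w|)) (palindrome-suffix pal |w|)
    where
    palindrome-suffix : ∀ {w t r} → PalindromeAt w t r → length w ≡ t + r + r → Palindrome (drop t w)
    -- A text of length t + 2r leaves no room for a nonempty `q`.
    palindrome-suffix (p , a , x ∷ q , refl , refl , refl) |w| =
      contradiction (trans (sym |w|) (trans (length-around p a (x ∷ q)) (+-suc _ _))) (m≢1+m+n _)
    palindrome-suffix (p , a , [] , refl , refl , refl) |w|
      rewrite drop-length-++ p (a ++ reverse a ++ []) | ++-identityʳ (reverse a) = begin
        a ++ reverse a                    ≡⟨ cong (_++ reverse a) (reverse-involutive a) ⟨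
        reverse (reverse a) ++ reverse a  ≡⟨ reverse-++ a (reverse a) ⟨
        reverse (a ++ reverse a)          ∎
      where open ≡-Reasoning

  -- Success says that `a ++ b ++ q` is a palindrome. The block `b ++ q` has the length of `a`, so
  -- dropping that many characters from both sides of the equation leaves `b ++ q` against
  -- `reverse a`.
  succeeds⇒palindromeAt : ∀ w t r → length w ≡ t + r + r → Succeeds w (suc (t + r)) →
    PalindromeAt w t r
  succeeds⇒palindromeAt w t r |w| succ
    with p , a , b , q , refl , refl , refl , |b| ← split-around t r w (≤-reflexive (sym |w|))
    = p , a , q , cong (λ s → p ++ a ++ s ++ q) b≡a⁻¹ , refl , refl
    where
    |bq| : length (b ++ q) ≡ length a
    |bq| = +-cancelˡ-≡ (length p + length a) _ _ (begin
      length p + length a + length (b ++ q)    ≡⟨ +-assoc (length p) _ _ ⟩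
      length p + (length a + length (b ++ q))  ≡⟨ cong (λ x → length p + x) (length-++ a) ⟨
      length p + length (a ++ b ++ q)          ≡⟨ length-++ p ⟨
      length (p ++ a ++ b ++ q)                ≡⟨ |w| ⟩
      length p + length a + length a           ∎)
      where open ≡-Reasoning
    palindrome : Palindrome (a ++ b ++ q)
    palindrome = subst Palindrome
      (trans (whole-factor (length p) (length a) |w|) (drop-length-++ p (a ++ b ++ q))) succ
    bq≡a⁻¹ : b ++ q ≡ reverse a
    bq≡a⁻¹ = begin
      b ++ q                                      ≡⟨ drop-length-++ a (b ++ q) ⟨
      drop (length a) (a ++ b ++ q)               ≡⟨ cong (drop (length a)) palindrome ⟩
      drop (length a) (reverse (a ++ b ++ q))     ≡⟨ cong (drop (length a)) (reverse-++ a (b ++ q)) ⟩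
      drop (length a) (reverse (b ++ q) ++ reverse a)
        ≡⟨ cong (λ k → drop k (reverse (b ++ q) ++ reverse a)) (trans (length-reverse (b ++ q)) |bq|) ⟨
      drop (length (reverse (b ++ q))) (reverse (b ++ q) ++ reverse a)
        ≡⟨ drop-length-++ (reverse (b ++ q)) (reverse a) ⟩
      reverse a                                   ∎
      where open ≡-Reasoning
    -- `b` is as long as `b ++ q`, so taking `length b` characters takes everything.
    b≡a⁻¹ : b ≡ reverse a
    b≡a⁻¹ = begin
      b                                      ≡⟨ take-length-++ b q ⟨
      take (length b) (b ++ q)               ≡⟨ cong₂ take (trans |b| (sym |bq|)) refl ⟩
      take (length (b ++ q)) (b ++ q)        ≡⟨ take-all (length (b ++ q)) (b ++ q) ≤-refl ⟩
      b ++ q                                 ≡⟨ bq≡a⁻¹ ⟩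
      reverse a                              ∎
      where open ≡-Reasoning

  -- Shrinking, aliveness and prefixes

  shrink₁ : ∀ {w t r} → PalindromeAt w t (suc r) → PalindromeAt w (suc t) r
  shrink₁ (p , x ∷ a , q , refl , refl , |a|) =
    p ++ x ∷ [] , a , x ∷ q , eq , trans (length-++ p) (+-comm (length p) 1) , suc-injective |a|
    where
    open ≡-Reasoning
    eq : p ++ x ∷ a ++ reverse (x ∷ a) ++ q ≡ (p ++ x ∷ []) ++ a ++ reverse a ++ x ∷ q
    eq = begin
      p ++ x ∷ a ++ reverse (x ∷ a) ++ q         ≡⟨ cong (λ s → p ++ x ∷ a ++ s ++ q) (unfold-reverse x a) ⟩
      p ++ x ∷ a ++ (reverse a ++ x ∷ []) ++ q   ≡⟨ cong (λ s → p ++ x ∷ a ++ s) (++-assoc (reverse a) _ q) ⟩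
      p ++ x ∷ a ++ reverse a ++ x ∷ q           ≡⟨ ++-assoc p _ _ ⟨
      (p ++ x ∷ []) ++ a ++ reverse a ++ x ∷ q   ∎

  -- Each peeled pair of end characters goes to the outer blocks. The start moves right while the
  -- center stays in place, which is how a start can be moved onto a landmark.
  shrink : ∀ {w t} k {r} → PalindromeAt w t (k + r) → PalindromeAt w (k + t) r
  shrink         zero        pal = pal
  shrink {w} {t} (suc k) {r} pal = subst (λ t → PalindromeAt w t r) (+-suc k t) (shrink k (shrink₁ pal))

  ends-equal : ∀ {w t r} → PalindromeAt w t (suc r) → w [ suc t ] ≡ w [ t + suc r + suc r ]
  ends-equal (p , x ∷ a , q , refl , refl , refl) =
    trans ([]-length-++ p x _) (sym (subst₂ (λ w k → w [ k ] ≡ just x) (sym eq) |u| ([]-length-++ u x q)))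
    where
    u : List A
    u = p ++ x ∷ a ++ reverse a
    eq : p ++ x ∷ a ++ reverse (x ∷ a) ++ q ≡ u ++ x ∷ q
    eq = begin
      p ++ x ∷ a ++ reverse (x ∷ a) ++ q         ≡⟨ cong (λ s → p ++ x ∷ a ++ s ++ q) (unfold-reverse x a) ⟩
      p ++ x ∷ a ++ (reverse a ++ x ∷ []) ++ q   ≡⟨ cong (λ s → p ++ x ∷ a ++ s) (++-assoc (reverse a) _ q) ⟩
      p ++ x ∷ a ++ reverse a ++ x ∷ q           ≡⟨ cong (p ++_) (++-assoc (x ∷ a) (reverse a) _) ⟨
      p ++ (x ∷ a ++ reverse a) ++ x ∷ q         ≡⟨ ++-assoc p _ _ ⟨
      u ++ x ∷ q                                 ∎
      where open ≡-Reasoning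
    |u| : suc (length u) ≡ length p + suc (length a) + suc (length a)
    |u| = begin
      suc (length u)                                          ≡⟨ cong suc (length-++ p) ⟩
      suc (length p + suc (length (a ++ reverse a)))
        ≡⟨ cong (λ k → suc (length p + suc k)) (trans (length-++ a) (cong (λ x → length a + x) (length-reverse a))) ⟩
      suc (length p + suc (length a + length a))              ≡⟨ arith (length p) (length a) ⟩
      length p + suc (length a) + suc (length a)              ∎
      where
      open ≡-Reasoning
      arith : ∀ t r → suc (t + suc (r + r)) ≡ t + suc r + suc r
      arith = solve-∀

  -- An offset Δ that stays inside the text satisfies Δ < r. Shrinking by r - (Δ + 1) turns the
  -- compared pair into the two ends of a palindrome, so `ends-equal` refutes a mismatch.
  palindromeAt⇒alive : ∀ {w t r} → PalindromeAt w t r → length w ≡ t + r + r →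
    Alive w (suc (t + r))
  palindromeAt⇒alive {w} {t} {r} pal |w| (Δ , fits , differ) = differ (begin
    w [ t + r ∸ Δ ]                    ≡⟨ cong (w [_]) left ⟩
    w [ suc (j + t) ]                  ≡⟨ ends-equal (shrink j (subst (PalindromeAt w t) r≡ pal)) ⟩
    w [ j + t + suc Δ + suc Δ ]        ≡⟨ cong (w [_]) right ⟨
    w [ suc (t + r + Δ) ]              ∎)
    where
    open ≡-Reasoning
    Δ<r : Δ < r
    Δ<r = +-cancelˡ-≤ (t + r) (suc Δ) r
      (≤-trans (≤-reflexive (+-suc (t + r) Δ)) (≤-trans fits (≤-reflexive |w|)))
    j : ℕ
    j = r ∸ suc Δ
    r≡ : r ≡ j + suc Δ
    r≡ = sym (m∸n+n≡m Δ<r)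
    left-arith : ∀ t j Δ → t + (j + suc Δ) ≡ suc (j + t) + Δ
    left-arith = solve-∀
    left : t + r ∸ Δ ≡ suc (j + t)
    left = trans (cong (_∸ Δ) (trans (cong (λ x → t + x) r≡) (left-arith t j Δ))) (m+n∸n≡m (suc (j + t)) Δ)
    right-arith : ∀ t j Δ → suc (t + (j + suc Δ) + Δ) ≡ j + t + suc Δ + suc Δ
    right-arith = solve-∀
    right : suc (t + r + Δ) ≡ j + t + suc Δ + suc Δ
    right = trans (cong (λ r → suc (t + r + Δ)) r≡) (right-arith t j Δ)

  palindromeAt-take⁻ : ∀ h {w t r} → PalindromeAt (take h w) t r → PalindromeAt w t r
  palindromeAt-take⁻ h {w} (p , a , q , eq , |p| , |a|) = p , a , q ++ drop h w , eq′ , |p| , |a|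
    where
    open ≡-Reasoning
    eq′ : w ≡ p ++ a ++ reverse a ++ q ++ drop h w
    eq′ = begin
      w                                             ≡⟨ take++drop≡id h w ⟨
      take h w ++ drop h w                          ≡⟨ cong (_++ drop h w) eq ⟩
      (p ++ a ++ reverse a ++ q) ++ drop h w        ≡⟨ ++-assoc p _ _ ⟩
      p ++ (a ++ reverse a ++ q) ++ drop h w        ≡⟨ cong (p ++_) (++-assoc a _ _) ⟩
      p ++ a ++ (reverse a ++ q) ++ drop h w        ≡⟨ cong (λ s → p ++ a ++ s) (++-assoc (reverse a) q _) ⟩
      p ++ a ++ reverse a ++ q ++ drop h w          ∎

  -- The palindrome is complete at position t + 2r, so cutting the text at `h` shortens only the
  -- block `q` behind it.
  palindromeAt-take⁺ : ∀ {h w t r} → t + r + r ≤ h → PalindromeAt w t r → PalindromeAt (take h w) t r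
  palindromeAt-take⁺ {h} t+2r≤h (p , a , q , refl , refl , refl) =
    p , a , take k q , eq , refl , refl
    where
    open ≡-Reasoning
    k : ℕ
    k = h ∸ (length p + length a + length a)
    h≡ : h ≡ length p + (length a + (length (reverse a) + k))
    h≡ = begin
      h                                                    ≡⟨ m+[n∸m]≡n t+2r≤h ⟨
      length p + length a + length a + k                   ≡⟨ cong (λ r → length p + length a + r + k) (length-reverse a) ⟨
      length p + length a + length (reverse a) + k         ≡⟨ +-assoc (length p + length a) _ k ⟩
      length p + length a + (length (reverse a) + k)       ≡⟨ +-assoc (length p) _ _ ⟩
      length p + (length a + (length (reverse a) + k))     ∎
    eq : take h (p ++ a ++ reverse a ++ q) ≡ p ++ a ++ reverse a ++ take k q
    eq = begin
      take h (p ++ a ++ reverse a ++ q)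
        ≡⟨ cong (λ h → take h (p ++ a ++ reverse a ++ q)) h≡ ⟩
      take (length p + (length a + (length (reverse a) + k))) (p ++ a ++ reverse a ++ q)
        ≡⟨ take-length+-++ p _ _ ⟩
      p ++ take (length a + (length (reverse a) + k)) (a ++ reverse a ++ q)
        ≡⟨ cong (p ++_) (take-length+-++ a _ _) ⟩
      p ++ a ++ take (length (reverse a) + k) (reverse a ++ q)
        ≡⟨ cong (λ s → p ++ a ++ s) (take-length+-++ (reverse a) q k) ⟩
      p ++ a ++ reverse a ++ take k q ∎

-- Landmarks and the centers that can be run

module _ {lv : Levels} where

  -- For t = m · 2^k the index within the level is ⌊h / 2^k⌋ - m. The bound `t ≤ h` makes this
  -- subtraction exact, and the bound on `h` from above makes the index smaller than D.
  landmark : ∀ D .{{_ : NonZero D}} {h t} (k : Fin (suc (L lv))) → b lv k ≡ D →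
    2 ^ toℕ k ∣ t → t ≤ h → h < t + D * 2 ^ toℕ k → Landmark lv h t
  landmark D {h} k bk≡D (divides m refl) t≤h h<t+D2^k =
    k , h/2^k ∸ m , ≤-trans i<D (≤-reflexive (sym bk≡D)) , m∸n≤m h/2^k m ,
    trans (*-comm m (2 ^ toℕ k)) (cong (2 ^ toℕ k *_) (sym (m∸[m∸n]≡n m≤)))
    where
    instance
      2^k≢0 : NonZero (2 ^ toℕ k)
      2^k≢0 = m^n≢0 2 (toℕ k)
    h/2^k : ℕ
    h/2^k = h ℕ./ 2 ^ toℕ k
    m≤ : m ≤ h/2^k
    m≤ = ≤-trans (≤-reflexive (sym (DivMod.m*n/n≡m m (2 ^ toℕ k)))) (DivMod./-monoˡ-≤ (2 ^ toℕ k) t≤h)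
    i<D : h/2^k ∸ m < D
    i<D = m<n+o⇒m∸n<o h/2^k m (DivMod.m<n*o⇒m/o<n
      (≤-trans h<t+D2^k (≤-reflexive (sym (*-distribʳ-+ (2 ^ toℕ k) m D)))))

  landmark-≤ : ∀ {h t} → Landmark lv h t → t ≤ h
  landmark-≤ {h} (k , i , _ , _ , refl) = begin
    2 ^ toℕ k * (h ℕ./ 2 ^ toℕ k ∸ i)  ≤⟨ *-monoʳ-≤ (2 ^ toℕ k) (m∸n≤m _ i) ⟩
    2 ^ toℕ k * (h ℕ./ 2 ^ toℕ k)      ≡⟨ *-comm (2 ^ toℕ k) _ ⟩
    h ℕ./ 2 ^ toℕ k * 2 ^ toℕ k        ≤⟨ DivMod.m/n*n≤m h (2 ^ toℕ k) ⟩
    h                                       ∎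
    where
    open ≤-Reasoning
    instance
      2^k≢0 : NonZero (2 ^ toℕ k)
      2^k≢0 = m^n≢0 2 (toℕ k)

  landmark⇒canRun : ∀ {A : Set} (w : List A) {t r} → length w ≡ t + r + r →
    Landmark lv (t + r + r) t → CanRun lv w (suc (t + r))
  landmark⇒canRun w {t} {r} |w| lm rewrite sym |w| =
    t , lm , trans (double t r) (cong (λ h → t + h + 2) (sym |w|))
    where
    double : ∀ t r → 2 * suc (t + r) ≡ t + (t + r + r) + 2
    double = solve-∀

  -- Brings a runnable center into the form t + r + 1 at time t + 2r, on which the palindrome lemmas
  -- work. Here r = h + 1 - c is the very value that `answer` records; the subtraction is exact
  -- because t ≤ h forces c ≤ h + 1.
  canRun-center : ∀ {A : Set} (w : List A) c → CanRun lv w c →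
    ∃[ t ] (c ≡ suc (t + (suc (length w) ∸ c)) ×
            length w ≡ t + (suc (length w) ∸ c) + (suc (length w) ∸ c))
  canRun-center w c (t , lm , 2c≡) = t , c≡ , suc-injective (trans (sym c+r≡) (cong (_+ r) c≡))
    where
    h r : ℕ
    h = length w
    r = suc h ∸ c
    top : ∀ h → h + h + 2 ≡ 2 * suc h
    top = solve-∀
    c≤1+h : c ≤ suc h
    c≤1+h = *-cancelˡ-≤ 2 (begin
      2 * c      ≡⟨ 2c≡ ⟩
      t + h + 2  ≤⟨ +-monoˡ-≤ 2 (+-monoˡ-≤ h (landmark-≤ lm)) ⟩
      h + h + 2  ≡⟨ top h ⟩
      2 * suc h  ∎)
      where open ≤-Reasoning
    c+r≡ : c + r ≡ suc h
    c+r≡ = m+[n∸m]≡n c≤1+h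
    c≡ : c ≡ suc (t + r)
    c≡ = +-cancelˡ-≡ c c (suc (t + r)) (begin
      c + c            ≡⟨ cong (λ x → c + x) (+-identityʳ c) ⟨
      2 * c            ≡⟨ 2c≡ ⟩
      t + h + 2        ≡⟨ shift t h ⟩
      suc (t + suc h)  ≡⟨ cong (λ k → suc (t + k)) c+r≡ ⟨
      suc (t + (c + r)) ≡⟨ swap t c r ⟩
      c + suc (t + r)  ∎)
      where
      open ≡-Reasoning
      shift : ∀ t h → t + h + 2 ≡ suc (t + suc h)
      shift = solve-∀
      swap : ∀ t c r → suc (t + (c + r)) ≡ c + suc (t + r)
      swap = solve-∀

-- The largest radius and its monotonicity in time

module _ {A : Set} (_≟_ : DecidableEquality A) where

  palindromeAt⇒≤largestRadius : ∀ {w t r} → PalindromeAt w t r → r ≤ largestRadius _≟_ w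
  -- With radius 0 the center may be `suc (length w)`, which is outside the list of centers.
  palindromeAt⇒≤largestRadius {r = zero} _ = z≤n
  palindromeAt⇒≤largestRadius {w} {t} {r@(suc r-1)} pal = ≤-trans r≤
    (All.lookup (xs≤max 0 (map (palindromicRadius _≟_ w) (applyUpTo suc (length w))))
      (∈-map⁺ (palindromicRadius _≟_ w) (∈-applyUpTo⁺ suc t+r<|w|)))
    where
    mirror : Mirror w (suc (t + r)) r
    mirror = palindromeAt⇒mirror pal
    r≤ : r ≤ palindromicRadius _≟_ w (suc (t + r))
    r≤ = All.lookup (xs≤max 0 _)
      (∈-filter⁺ (mirror? _≟_ w (suc (t + r))) (∈-upTo⁺ (proj₁ mirror)) mirror)
    t+r<|w| : t + r < length w
    t+r<|w| = ≤-trans (m<m+n (t + r) (s≤s z≤n)) (length-palindromeAt pal)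

  -- A maximum with base value 0 is either that base value or an element of the list, and the
  -- elements are filtered by `mirror?`.
  palindromicRadius-attained : ∀ w c →
    palindromicRadius _≟_ w c ≡ 0 ⊎ ∃[ t ] PalindromeAt w t (palindromicRadius _≟_ w c)
  palindromicRadius-attained w c
    with argmax-sel id 0 (filter (mirror? _≟_ w c) (upTo c))
  ... | inj₁ ≡0 = inj₁ ≡0
  ... | inj₂ r∈ with t , _ , pal ← mirror⇒palindromeAt-center
                       (proj₂ (∈-filter⁻ (mirror? _≟_ w c) {xs = upTo c} r∈)) = inj₂ (t , pal)

  largestRadius-attained : ∀ w →
    largestRadius _≟_ w ≡ 0 ⊎ ∃[ t ] PalindromeAt w t (largestRadius _≟_ w)
  largestRadius-attained w
    with argmax-sel id 0 (map (palindromicRadius _≟_ w) (applyUpTo suc (length w)))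
  ... | inj₁ ≡0 = inj₁ ≡0
  ... | inj₂ R∈ with c , _ , R≡ ← ∈-map⁻ (palindromicRadius _≟_ w) R∈
      with palindromicRadius-attained w c
  ...    | inj₁ ≡0        = inj₁ (trans R≡ ≡0)
  ...    | inj₂ (t , pal) = inj₂ (t , subst (PalindromeAt w t) (sym R≡) pal)

  largestRadius-take-mono : ∀ {h h′} T → h ≤ h′ →
    largestRadius _≟_ (take h T) ≤ largestRadius _≟_ (take h′ T)
  largestRadius-take-mono {h} {h′} T h≤h′ with largestRadius-attained (take h T)
  ... | inj₁ ≡0 = ≤-trans (≤-reflexive ≡0) z≤n
  ... | inj₂ (t , pal) = palindromeAt⇒≤largestRadius
    (palindromeAt-take⁺ (≤-trans fits h≤h′) (palindromeAt-take⁻ h pal))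
    where
    fits : t + largestRadius _≟_ (take h T) + largestRadius _≟_ (take h T) ≤ h
    fits = ≤-trans (length-palindromeAt pal) (≤-trans (≤-reflexive (length-take h T)) (m⊓n≤m h _))

  -- The answer reported by a scheme

  module _ {n : ℕ} {lv : Levels} (S : Scheme A n lv) where
    open Scheme S

    -- If P(c) is skipped because a smaller center is sure to succeed, pass to
    -- that center; this descent stops at a process which is actually run.
    succeeds⇒smaller-run : ∀ w → 1 ≤ length w → length w ≤ n →
      ∀ c → CanRun lv w c → Succeeds w c → ∃[ c′ ] (c′ ≤ c × c′ ∈ runs w × Succeeds w c′)
    succeeds⇒smaller-run w 1≤h h≤n = <-rec Reported step
      where
      Reported : ℕ → Set
      Reported c = CanRun lv w c → Succeeds w c → ∃[ c′ ] (c′ ≤ c × c′ ∈ runs w × Succeeds w c′)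
      -- The guarantee speaks of alive processes only, so aliveness is recovered from success at
      -- each center of the descent.
      alive : ∀ {c} → CanRun lv w c → Succeeds w c → Alive w c
      alive {c} can succ with t , c≡ , |w| ← canRun-center w c can =
        subst (Alive w) (sym c≡)
          (palindromeAt⇒alive (succeeds⇒palindromeAt w t _ |w| (subst (Succeeds w) c≡ succ)) |w|)
      step : ∀ c → (∀ {c′} → c′ < c → Reported c′) → Reported c
      step c rec can succ with guarantee w 1≤h h≤n c (alive can succ) can
      ... | inj₁ c∈runs = c , ≤-refl , c∈runs , succ
      ... | inj₂ (inj₁ fails) = contradiction succ (sureFails-sound w 1≤h h≤n c can fails)
      ... | inj₂ (inj₂ (c′ , c′<c , can′ , sure))
          with c″ , c″≤c′ , c″∈runs , succ″ ←
                 rec c′<c can′ (sureSucceeds-sound w 1≤h h≤n c′ can′ sure)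
          = c″ , ≤-trans c″≤c′ (<⇒≤ c′<c) , c″∈runs , succ″

    module _ (T : List A) (|T| : length T ≡ n) where

      length-prefix : ∀ {h} → h ≤ n → length (take h T) ≡ h
      length-prefix {h} h≤n =
        trans (length-take h T) (m≤n⇒m⊓n≡m (≤-trans h≤n (≤-reflexive (sym |T|))))

      -- Induction on time: the bound on the previous answer survives because the largest radius
      -- does not decrease, and each newly recorded value is the radius of a palindrome that ends at
      -- `h`.
      answer≤largestRadius : ∀ h → h ≤ n → answer _≟_ S T h ≤ largestRadius _≟_ (take h T)
      answer≤largestRadius zero      _   = z≤n
      answer≤largestRadius h@(suc h-1) h≤n = max≤v⁺
        (≤-trans (answer≤largestRadius h-1 (≤-trans (n≤1+n h-1) h≤n)) (largestRadius-take-mono T (n≤1+n h-1)))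
        (All.tabulate run≤)
        where
        w : List A
        w = take h T
        |w|≡h : length w ≡ h
        |w|≡h = length-prefix h≤n
        run≤ : ∀ {v} → v ∈ map (λ c → suc h ∸ c) (filter (succeeds? _≟_ w) (runs w)) →
          v ≤ largestRadius _≟_ w
        run≤ v∈ with c , c∈ , refl ← ∈-map⁻ (λ c → suc h ∸ c) v∈
                with c∈runs , succ ← ∈-filter⁻ (succeeds? _≟_ w) {xs = runs w} c∈
                with t , c≡ , |w| ← canRun-center w c (runs-canRun w
                       (≤-trans (s≤s z≤n) (≤-reflexive (sym |w|≡h))) (≤-trans (≤-reflexive |w|≡h) h≤n) c c∈runs)
          = ≤-trans (≤-reflexive (cong (λ h → suc h ∸ c) (sym |w|≡h)))
              (palindromeAt⇒≤largestRadius
                (succeeds⇒palindromeAt w t _ |w| (subst (Succeeds w) c≡ succ)))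

      answer-step : ∀ h → answer _≟_ S T h ≤ answer _≟_ S T (suc h)
      answer-step h = ⊥≤max (answer _≟_ S T h)
        (map (λ c → suc (suc h) ∸ c) (filter (succeeds? _≟_ (take (suc h) T)) (runs (take (suc h) T))))

      answer-mono : ∀ {h h′} → h ≤ h′ → answer _≟_ S T h ≤ answer _≟_ S T h′
      answer-mono h≤h′ = go (≤⇒≤′ h≤h′)
        where
        go : ∀ {h h′} → h ≤′ h′ → answer _≟_ S T h ≤ answer _≟_ S T h′
        go ≤′-refl        = ≤-refl
        go (≤′-step h≤h′) = ≤-trans (go h≤h′) (answer-step _)

      succeeds⇒≤answer : ∀ h c → 1 ≤ h → h ≤ n → CanRun lv (take h T) c → Succeeds (take h T) c →
        suc h ∸ c ≤ answer _≟_ S T h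
      succeeds⇒≤answer h@(suc h-1) c _ h≤n can succ =
        let c′ , c′≤c , c′∈runs , succ′ = succeeds⇒smaller-run w
              (≤-trans (s≤s z≤n) (≤-reflexive (sym |w|≡h))) (≤-trans (≤-reflexive |w|≡h) h≤n) c can succ
        -- The process actually run has center `c′ ≤ c`, and a smaller center records a larger
        -- radius.
        in ≤-trans (∸-monoʳ-≤ (suc h) c′≤c)
            (All.lookup (xs≤max (answer _≟_ S T h-1) (map (λ c → suc h ∸ c) (filter (succeeds? _≟_ w) (runs w))))
              (∈-map⁺ (λ c → suc h ∸ c) (∈-filter⁺ (succeeds? _≟_ w) c′∈runs succ′)))
        where
        w : List A
        w = take h T
        |w|≡h : length w ≡ h
        |w|≡h = length-prefix h≤n

      -- At time t + 2r the palindrome is a suffix of the text read and its process can be run and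
      -- succeeds. The answer is then at least `r` and never decreases up to `h`.
      landmark⇒≤answer : ∀ {h t r} → t + r + r ≤ h → h ≤ n → PalindromeAt T t r →
        Landmark lv (t + r + r) t → r ≤ answer _≟_ S T h
      -- Radius 0 is set apart because t + 2r could then be time 0, while the guarantee starts at
      -- time 1.
      landmark⇒≤answer {r = zero} _ _ _ _ = z≤n
      landmark⇒≤answer {h} {t} {r@(suc r-1)} t+2r≤h h≤n pal lm = begin
        r                                       ≡⟨ m+n∸m≡n (suc (t + r)) r ⟨
        suc (t + r + r) ∸ suc (t + r)
          ≤⟨ succeeds⇒≤answer (t + r + r) (suc (t + r)) (≤-trans (s≤s z≤n) (m≤n+m r (t + r))) t+2r≤n
               (landmark⇒canRun (take (t + r + r) T) |w| lm) (palindromeAt⇒succeeds (palindromeAt-take⁺ ≤-refl pal) |w|) ⟩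
        answer _≟_ S T (t + r + r)              ≤⟨ answer-mono t+2r≤h ⟩
        answer _≟_ S T h                        ∎
        where
        open ≤-Reasoning
        t+2r≤n : t + r + r ≤ n
        t+2r≤n = ≤-trans t+2r≤h h≤n
        |w| : length (take (t + r + r) T) ≡ t + r + r
        |w| = length-prefix t+2r≤n

-- Choosing the level and the shift

dyadic-scale : ∀ D R l → R + R ≤ D * 2 ^ l →
  R + R < D ⊎ ∃[ k ] (k ≤ l × R + R ≤ D * 2 ^ k × D * 2 ^ k ≤ 4 * R)
dyadic-scale D R zero 2R≤D1 with R + R <? D
... | yes 2R<D = inj₁ 2R<D
-- Exponent 0 has no predecessor whose failure could bound D from above; failure of `R + R < D`
-- takes its place.
... | no  2R≮D = inj₂ (0 , z≤n , 2R≤D1 , (begin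
    D * 1    ≡⟨ *-identityʳ D ⟩
    D        ≤⟨ ≮⇒≥ 2R≮D ⟩
    R + R    ≤⟨ m≤m+n (R + R) (R + R) ⟩
    R + R + (R + R) ≡⟨ quadruple R ⟩
    4 * R    ∎))
  where
  open ≤-Reasoning
  quadruple : ∀ R → R + R + (R + R) ≡ 4 * R
  quadruple = solve-∀
dyadic-scale D R (suc l) 2R≤ with R + R ≤? D * 2 ^ l
... | yes 2R≤′ with dyadic-scale D R l 2R≤′
...   | inj₁ 2R<D                = inj₁ 2R<D
...   | inj₂ (k , k≤l , lo , hi) = inj₂ (k , ≤-trans k≤l (n≤1+n l) , lo , hi)
-- Exponent `l` fails, so D · 2^l < 2R, and doubling gives the upper bound 4R.
dyadic-scale D R (suc l) 2R≤ | no 2R≰ = inj₂ (suc l , ≤-refl , 2R≤ , (begin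
    D * (2 * 2 ^ l)  ≡⟨ double D (2 ^ l) ⟩
    2 * (D * 2 ^ l)  ≤⟨ *-monoʳ-≤ 2 (<⇒≤ (≰⇒> 2R≰)) ⟩
    2 * (R + R)      ≡⟨ quadruple R ⟩
    4 * R            ∎))
  where
  open ≤-Reasoning
  double : ∀ D m → D * (2 * m) ≡ 2 * (D * m)
  double = solve-∀
  quadruple : ∀ R → 2 * (R + R) ≡ 4 * R
  quadruple = solve-∀

-- The shift is m, not 0, when `t` is already a multiple. A positive shift makes the shrunken radius
-- strictly smaller than R, which supplies the strict inequality required by `landmark`.
next-multiple : ∀ m .{{_ : NonZero m}} t → ∃[ k ] (1 ≤ k × k ≤ m × m ∣ k + t)
next-multiple m t =
  m ∸ t % m , m<n⇒0<n∸m (DivMod.m%n<n t m) , m∸n≤m m (t % m) , divides (suc (t ℕ./ m)) (begin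
    m ∸ t % m + t                                ≡⟨ cong (λ x → m ∸ t % m + x) (DivMod.m≡m%n+[m/n]*n t m) ⟩
    m ∸ t % m + (t % m + t ℕ./ m * m)       ≡⟨ +-assoc (m ∸ t % m) _ _ ⟨
    m ∸ t % m + t % m + t ℕ./ m * m         ≡⟨ cong (_+ t ℕ./ m * m) (m∸n+n≡m (DivMod.m%n≤n t m)) ⟩
    suc (t ℕ./ m) * m                       ∎)
  where open ≡-Reasoning

module _ {D : ℕ} (6≤D : 6 ≤ D) where

  -- Follows from 4k ≤ Dk; it ensures that a palindrome of radius R can be shrunk by k.
  shift≤ : ∀ {k R} → D * k ≤ 4 * R → k ≤ R
  shift≤ {k} {R} Dk≤4R = *-cancelˡ-≤ 4 (begin
    4 * k  ≤⟨ *-monoˡ-≤ k (≤-trans (m≤n+m 4 2) 6≤D) ⟩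
    D * k  ≤⟨ Dk≤4R ⟩
    4 * R  ∎)
    where open ≤-Reasoning

  -- 6k ≤ Dk ≤ 4(k + r) gives k ≤ 2r, whence Dk ≤ 12r.
  shift-error : ∀ {k r} → D * k ≤ 4 * (k + r) → (k + r) * D ≤ (D + 12) * r
  shift-error {k} {r} Dk≤ = begin
    (k + r) * D           ≡⟨ expand k r D ⟩
    D * k + D * r         ≤⟨ +-monoˡ-≤ (D * r) Dk≤ ⟩
    4 * (k + r) + D * r   ≤⟨ +-monoˡ-≤ (D * r) (*-monoʳ-≤ 4 (+-monoˡ-≤ r k≤2r)) ⟩
    4 * (2 * r + r) + D * r ≡⟨ collect D r ⟩
    (D + 12) * r          ∎
    where
    open ≤-Reasoning
    expand : ∀ k r D → (k + r) * D ≡ D * k + D * r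
    expand = solve-∀
    collect : ∀ D r → 4 * (2 * r + r) + D * r ≡ (D + 12) * r
    collect = solve-∀
    distrib : ∀ k r → 4 * (k + r) ≡ 4 * k + 2 * (2 * r)
    distrib = solve-∀
    split : ∀ k → 6 * k ≡ 4 * k + 2 * k
    split = solve-∀
    k≤2r : k ≤ 2 * r
    k≤2r = *-cancelˡ-≤ 2 (+-cancelˡ-≤ (4 * k) (2 * k) (2 * (2 * r)) (begin
      4 * k + 2 * k        ≡⟨ split k ⟨
      6 * k                ≤⟨ *-monoˡ-≤ k 6≤D ⟩
      D * k                ≤⟨ Dk≤ ⟩
      4 * (k + r)          ≡⟨ distrib k r ⟩
      4 * k + 2 * (2 * r)  ∎))

-- The approximation bound over the natural numbers

module _ {A : Set} (_≟_ : DecidableEquality A) {n D : ℕ} .{{_ : NonZero D}} {lv : Levels}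
         (6≤D : 6 ≤ D) (n≡ : n ≡ D * 2 ^ L lv) (b≡D : ∀ k → b lv k ≡ D) (S : Scheme A n lv)
         (T : List A) (|T| : length T ≡ n) {h : ℕ} (h≤n : h ≤ n) where

  -- This is R ≤ (1 + 12/D) · ℓ multiplied by D, with ℓ the answer at time `h`.
  palindromeAt⇒answer-approx : ∀ {t R} → t + R + R ≤ h → PalindromeAt T t R →
    R * D ≤ (D + 12) * answer _≟_ S T h
  palindromeAt⇒answer-approx {t} {R} t+2R≤h pal with dyadic-scale D R (L lv) 2R≤D2^L
    where
    -- The text has length D · 2^L, so the last level is coarse enough for every palindrome.
    2R≤D2^L : R + R ≤ D * 2 ^ L lv
    2R≤D2^L = begin
      R + R         ≤⟨ m≤n+m (R + R) t ⟩
      t + (R + R)   ≡⟨ +-assoc t R R ⟨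
      t + R + R     ≤⟨ t+2R≤h ⟩
      h             ≤⟨ h≤n ⟩
      n             ≡⟨ n≡ ⟩
      D * 2 ^ L lv  ∎
      where open ≤-Reasoning
  -- Every position is a multiple of 2^0, so nothing is cut off and the radius R itself is reached.
  ... | inj₁ 2R<D = begin
      R * D                              ≡⟨ *-comm R D ⟩
      D * R                              ≤⟨ *-mono-≤ (m≤m+n D 12) (landmark⇒≤answer _≟_ S T |T| t+2R≤h h≤n pal lm) ⟩
      (D + 12) * answer _≟_ S T h        ∎
    where
    open ≤-Reasoning
    lm : Landmark lv (t + R + R) t
    lm = landmark D zero (b≡D zero) (1∣ t) (≤-trans (m≤m+n t R) (m≤m+n (t + R) R)) (begin-strict
      t + R + R    ≡⟨ +-assoc t R R ⟩
      t + (R + R)  <⟨ +-monoʳ-< t 2R<D ⟩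
      t + D        ≡⟨ cong (λ x → t + x) (*-identityʳ D) ⟨
      t + D * 1    ∎)
  ... | inj₂ (l , l≤L , 2R≤ , ≤4R)
    with k , 1≤k , k≤2^l , 2^l∣k+t ← next-multiple (2 ^ l) {{m^n≢0 2 l}} t
    = subst (λ R → R * D ≤ (D + 12) * answer _≟_ S T h) k+r≡R (begin
        (k + r) * D                  ≤⟨ shift-error 6≤D (≤-trans Dk≤4R (≤-reflexive (cong (4 *_) (sym k+r≡R)))) ⟩
        (D + 12) * r                 ≤⟨ *-monoʳ-≤ (D + 12) (landmark⇒≤answer _≟_ S T |T| fits h≤n shrunk lm) ⟩
        (D + 12) * answer _≟_ S T h  ∎)
    where
    open ≤-Reasoning
    r : ℕ
    r = R ∸ k
    Dk≤4R : D * k ≤ 4 * R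
    Dk≤4R = ≤-trans (*-monoʳ-≤ D k≤2^l) ≤4R
    k+r≡R : k + r ≡ R
    k+r≡R = m+[n∸m]≡n (shift≤ 6≤D Dk≤4R)
    shrunk : PalindromeAt T (k + t) r
    shrunk = shrink k (subst (PalindromeAt T t) (sym k+r≡R) pal)
    r≤R : r ≤ R
    r≤R = m∸n≤m R k
    fits : k + t + r + r ≤ h
    fits = begin
      k + t + r + r    ≡⟨ rearrange k t r ⟩
      t + (k + r) + r  ≡⟨ cong (λ R → t + R + r) k+r≡R ⟩
      t + R + r        ≤⟨ +-monoʳ-≤ (t + R) r≤R ⟩
      t + R + R        ≤⟨ t+2R≤h ⟩
      h                ∎
      where
      rearrange : ∀ k t r → k + t + r + r ≡ t + (k + r) + r
      rearrange = solve-∀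
    -- When the shrunken palindrome has just been read, its start lies 2r behind the current time;
    -- `1 ≤ k` gives r < R and hence strictness.
    r+r<D2^l : r + r < D * 2 ^ l
    r+r<D2^l = begin-strict
      r + r      <⟨ +-monoˡ-< r (≤-trans (+-monoˡ-≤ r 1≤k) (≤-reflexive k+r≡R)) ⟩
      R + r      ≤⟨ +-monoʳ-≤ R r≤R ⟩
      R + R      ≤⟨ 2R≤ ⟩
      D * 2 ^ l  ∎
    level : Fin (suc (L lv))
    level = fromℕ< (s≤s l≤L)
    lm : Landmark lv (k + t + r + r) (k + t)
    lm = landmark D level (b≡D level)
      (subst (λ l → 2 ^ l ∣ k + t) (sym (toℕ-fromℕ< (s≤s l≤L))) 2^l∣k+t)
      (≤-trans (m≤m+n (k + t) r) (m≤m+n (k + t + r) r))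
      (begin-strict
        k + t + r + r                ≡⟨ +-assoc (k + t) r r ⟩
        k + t + (r + r)              <⟨ +-monoʳ-< (k + t) r+r<D2^l ⟩
        k + t + D * 2 ^ l            ≡⟨ cong (λ l → k + t + D * 2 ^ l) (toℕ-fromℕ< (s≤s l≤L)) ⟨
        k + t + D * 2 ^ toℕ level    ∎)

  largestRadius-answer-approx :
    largestRadius _≟_ (take h T) * D ≤ (D + 12) * answer _≟_ S T h
  largestRadius-answer-approx with largestRadius-attained _≟_ (take h T)
  ... | inj₁ ≡0 rewrite ≡0 = z≤n
  ... | inj₂ (t , pal) = palindromeAt⇒answer-approx
    (≤-trans (length-palindromeAt pal) (≤-trans (≤-reflexive (length-take h T)) (m⊓n≤m h (length T))))
    (palindromeAt-take⁻ h pal)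

-- Passing to rational numbers

cross-multiplied⇒≤ : ∀ R ℓ D C .{{_ : NonZero D}} → R * D ≤ (D + C) * ℓ →
  (+ R / 1) ℚ.≤ (1ℚ ℚ.+ + C / D) ℚ.* (+ ℓ / 1)
-- In unnormalised rationals the right side computes to a fraction with denominator `1 * D * 1`, so
-- the comparison becomes an integer inequality with no common factors to cancel.
cross-multiplied⇒≤ R ℓ D@(suc d) C RD≤ = ℚₚ.toℚᵘ-cancel-≤ (begin
    ℚ.toℚᵘ (+ R / 1)                                    ≃⟨ ℚₚ.toℚᵘ-fromℚᵘ (ℚᵘ.mkℚᵘ (+ R) 0) ⟩
    ℚᵘ.mkℚᵘ (+ R) 0                                     ≤⟨ ℚᵘ.*≤* cross ⟩
    (ℚᵘ.1ℚᵘ ℚᵘ.+ ℚᵘ.mkℚᵘ (+ C) d) ℚᵘ.* ℚᵘ.mkℚᵘ (+ ℓ) 0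
      ≃⟨ ℚᵘₚ.*-cong (ℚᵘₚ.+-congʳ ℚᵘ.1ℚᵘ (ℚₚ.toℚᵘ-fromℚᵘ (ℚᵘ.mkℚᵘ (+ C) d)))
                    (ℚₚ.toℚᵘ-fromℚᵘ (ℚᵘ.mkℚᵘ (+ ℓ) 0)) ⟨
    (ℚᵘ.1ℚᵘ ℚᵘ.+ ℚ.toℚᵘ (+ C / D)) ℚᵘ.* ℚ.toℚᵘ (+ ℓ / 1)
      ≃⟨ ℚᵘₚ.*-congʳ (ℚₚ.toℚᵘ-homo-+ 1ℚ (+ C / D)) ⟨
    ℚ.toℚᵘ (1ℚ ℚ.+ + C / D) ℚᵘ.* ℚ.toℚᵘ (+ ℓ / 1)
      ≃⟨ ℚₚ.toℚᵘ-homo-* (1ℚ ℚ.+ + C / D) (+ ℓ / 1) ⟨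
    ℚ.toℚᵘ ((1ℚ ℚ.+ + C / D) ℚ.* (+ ℓ / 1))          ∎)
  where
  open ℚᵘₚ.≤-Reasoning
  N : ℕ
  N = (D + C) * ℓ
  numerator : (ℤ.1ℤ ℤ.* + D ℤ.+ + C ℤ.* ℤ.1ℤ) ℤ.* + ℓ ℤ.* ℤ.1ℤ ≡ + N
  numerator = trans (ℤₚ.*-identityʳ _) (trans
    (cong (ℤ._* + ℓ) (cong₂ ℤ._+_ (ℤₚ.*-identityˡ (+ D)) (ℤₚ.*-identityʳ (+ C))))
    (sym (ℤₚ.pos-* (D + C) ℓ)))
  denominator : 1 * D * 1 ≡ D
  denominator = trans (*-identityʳ (1 * D)) (*-identityˡ D)
  cross : + R ℤ.* + (1 * D * 1) ℤ.≤ (ℤ.1ℤ ℤ.* + D ℤ.+ + C ℤ.* ℤ.1ℤ) ℤ.* + ℓ ℤ.* ℤ.1ℤ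
  cross = subst₂ ℤ._≤_
    (trans (ℤₚ.pos-* R D) (cong (λ k → + R ℤ.* + k) (sym denominator)))
    (sym numerator) (ℤ.+≤+ RD≤)

theorem3p3 : ∃[ C ] (∀ {A : Set} (_≟_ : DecidableEquality A) (n D : ℕ) .{{_ : NonZero D}} (lv : Levels) →
    6 ≤ D →
    n ≡ D * 2 ^ Levels.L lv →
    (∀ k → Levels.b lv k ≡ D) →
    (S : Scheme A n lv) →
    Approximates _≟_ S (+ C / D))
theorem3p3 = 12 , λ _≟_ n D lv 6≤D n≡ b≡D S T |T| h _ h≤n →
    answer≤largestRadius _≟_ S T |T| h h≤n
  -- The constant 12 arises in `shift-error`: 4(k + r) ≤ 12r once k ≤ 2r.
  , cross-multiplied⇒≤ (largestRadius _≟_ (take h T)) (answer _≟_ S T h) D 12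
      (largestRadius-answer-approx _≟_ 6≤D n≡ b≡D S T |T| h≤n)
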